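{- Let $G$ be a cubic graph (every vertex has degree $3$). Then $P^1(G)\leq 3$; that is, there is a proper pushing scheme $\rho:V(G)\to\{0,1,2,3\}$ of $G$.
   Context: Graphs are finite, simple and undirected. For a graph $G$, a function $\rho:V(G)\to\mathbb{N}_0$ (where $\mathbb{N}_0=\{0,1,2,\dots\}$) is a proper pushing scheme of $G$ if the function $\sigma:V(G)\to\mathbb{N}_0$, $\sigma(u)=(1+\rho(u))d_G(u)+\sum_{v\in N_G(u)}\rho(v)$, satisfies $\sigma(u)\neq\sigma(v)$ for every edge $uv$ of $G$. A graph is nice if it has no connected component of order two (cubic graphs are nice). For a nice graph $G$, $P^1(G)=\min\{\max_{u\in V(G)}\rho(u): \rho \text{ a proper pushing scheme of } G\}$. -}

module Defs where

open import Data.Nat using (ℕ; zero; suc; _+_; _*_)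
open import Data.Fin using (Fin; toℕ)
open import Data.Bool using (Bool; true; false; if_then_else_)
open import Data.Vec.Functional using (foldr)
open import Relation.Binary.PropositionalEquality using (_≡_; _≢_)

record Graph (n : ℕ) : Set where
  field
    adj     : Fin n → Fin n → Bool
    sym     : ∀ u v → adj u v ≡ adj v u
    irrefl  : ∀ u → adj u u ≡ false

open Graph public

sumFin : ∀ {n} → (Fin n → ℕ) → ℕ
sumFin f = foldr _+_ 0 f

degree : ∀ {n} → Graph n → Fin n → ℕ
degree G u = sumFin (λ v → if adj G u v then 1 else 0)

Cubic : ∀ {n} → Graph n → Set
Cubic G = ∀ u → degree G u ≡ 3

sigma : ∀ {n} → Graph n → (Fin n → ℕ) → Fin n → ℕ
sigma G ρ u = (1 + ρ u) * degree G u + sumFin (λ v → if adj G u v then ρ v else 0)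

ProperPushingScheme : ∀ {n} → Graph n → (Fin n → ℕ) → Set
ProperPushingScheme G ρ = ∀ u v → adj G u v ≡ true → sigma G ρ u ≢ sigma G ρ v

{-# OPTIONS --safe #-}
module Submission where

open import Defs
open import Algebra.Properties.Semiring.Sum using (sum-cong-≗; ∑-distrib-+; *-distribˡ-sum)
open import Data.Bool using (Bool; true; false; not; _∧_; _∨_; _xor_; if_then_else_; T) renaming (_≟_ to _≟ᵇ_)
open import Data.Bool.Properties using (not-involutive; ∧-comm)
open import Data.Empty using (⊥)
open import Data.Fin using (Fin; zero; suc; toℕ; _≟_)
open import Data.Fin.Patterns using (0F; 1F; 2F; 4F)
open import Data.Fin.Properties using (any?; all?; toℕ≤pred[n])
open import Data.List using ([]; _∷_; map)
open import Data.List.Properties using (map-∘)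
open import Data.List.Relation.Unary.All using (All; []; _∷_)
open import Data.List.Relation.Unary.All.Properties using (map⁺)
open import Data.Nat using (ℕ; zero; suc; _+_; _*_; _∸_; _≤_; _<_; z≤n; s≤s; s≤s⁻¹; _≡ᵇ_; _<?_)
open import Data.Nat.Induction using (<-wellFounded)
open import Data.Nat.ListAction using (sum)
open import Data.Nat.Properties renaming (_≟_ to _≟ⁿ_)
open import Data.Nat.Tactic.RingSolver using (solve-∀)
open import Data.Product using (Σ; ∃; _×_; _,_; proj₁; proj₂)
open import Data.Sum using (_⊎_; inj₁; inj₂)
open import Data.Vec.Functional using (updateAt)
open import Data.Vec.Functional.Properties using (updateAt-updates; updateAt-minimal)
open import Function using (_∘_; const)
open import Induction.WellFounded using (Acc; acc)
open import Relation.Binary.PropositionalEquality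
  using (_≡_; _≢_; refl; trans; cong; cong₂; subst; subst₂; module ≡-Reasoning) renaming (sym to ≡-sym)
open import Relation.Nullary using (Dec; yes; no; does; contradiction)
open import Relation.Nullary.Decidable using (map′; _×-dec_; _⊎-dec_; _→-dec_; dec-true; from-yes)

-- Take a locally maximal cut: every vertex has at most one neighbour on its
-- own side. Starting from ρ = 0 on the false side and ρ = 3 on the true side,
-- shift one vertex of each monochromatic edge by 1 towards the other side. This
-- gives σ = 12 − d on the false side and σ = 12 + d on the true side with
-- d ≥ 0, so an edge across the cut is in conflict only if d = 0 at both ends.
-- Choosing the shifted vertices so that the number of cut edges with both ends
-- shifted is minimal under swaps settles the monochromatic edges.
--
-- The remaining trouble is with true vertices v that have no monochromatic edge
-- and no shifted neighbour. Shifting these freely by 0, …, 3 gives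
-- σ(v) = 12 − 3 shift(v), and an edge uv is in conflict iff shift(v) is the mean
-- of the shifts around u (a monochromatic neighbour of u counting as 2). Such
-- means are avoided by another descent: an edge uv forbids at most one value at v,
-- unless the other two neighbours of u are both free with values 1 and 2, and
-- there are only three edges at v. Penalising the values 1 and 2 makes the
-- exceptional case harmless.

-- Descent and finite sums.

private variable
  n : ℕ
  f g : Fin n → ℕ

-- Local search stops because `_<_` is well-founded. The cut, the transversal and the mean-free
-- values are all obtained this way, each with its own energy.
descend : {X : Set} {Goal : X → Set} (E : X → ℕ) →
          (∀ x → Goal x ⊎ ∃ λ x′ → E x′ < E x) → X → ∃ Goal
descend {X} {Goal} E step x₀ = go x₀ (<-wellFounded (E x₀))
  where
  go : ∀ x → Acc _<_ (E x) → ∃ Goal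
  go x (acc rs) with step x
  ... | inj₁ good        = x , good
  ... | inj₂ (x′ , E′<E) = go x′ (rs E′<E)

sum-cong : (∀ v → f v ≡ g v) → sumFin f ≡ sumFin g
sum-cong = sum-cong-≗ +-*-semiring

sum-+ : ∀ (f g : Fin n → ℕ) → sumFin (λ v → f v + g v) ≡ sumFin f + sumFin g
sum-+ = ∑-distrib-+ +-*-semiring

sum-mono : ∀ {n} {f g : Fin n → ℕ} → (∀ v → f v ≤ g v) → sumFin f ≤ sumFin g
sum-mono {zero}  f≤g = z≤n
sum-mono {suc n} f≤g = +-mono-≤ (f≤g zero) (sum-mono (f≤g ∘ suc))

sum-zero : ∀ n → sumFin {n} (λ _ → 0) ≡ 0
sum-zero zero    = refl
sum-zero (suc n) = sum-zero n

-- Zeroing the entry instead of deleting it keeps the index type `Fin n`.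
except : Fin n → (Fin n → ℕ) → Fin n → ℕ
except v f w = if does (w ≟ v) then 0 else f w

sum-at : ∀ (v : Fin n) f → sumFin f ≡ f v + sumFin (except v f)
sum-at zero    f = refl
sum-at (suc v) f = begin
  f zero + sumFin (f ∘ suc)                               ≡⟨ cong (f zero +_) (sum-at v (f ∘ suc)) ⟩
  f zero + (f (suc v) + sumFin (except v (f ∘ suc)))      ≡⟨ swap (f zero) (f (suc v)) _ ⟩
  f (suc v) + (f zero + sumFin (except v (f ∘ suc)))      ∎
  where
  open ≡-Reasoning
  swap : ∀ a b c → a + (b + c) ≡ b + (a + c)
  swap = solve-∀

except-cong : ∀ (v : Fin n) → (∀ w → w ≢ v → f w ≡ g w) → ∀ w → except v f w ≡ except v g w
except-cong v eq w with w ≟ v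
... | yes _  = refl
... | no w≢v = eq w w≢v

-- Shaped so that `degree` and the neighbour sum in `sigma` are instances by definition.
over : (Fin n → Bool) → (Fin n → ℕ) → ℕ
over P f = sumFin (λ v → if P v then f v else 0)

over-cong : ∀ (P : Fin n → Bool) → (∀ v → P v ≡ true → f v ≡ g v) → over P f ≡ over P g
over-cong {f = f} {g} P eq = sum-cong pointwise
  where
  pointwise : ∀ v → (if P v then f v else 0) ≡ (if P v then g v else 0)
  pointwise v with P v in Pv
  ... | true  = eq v Pv
  ... | false = refl

over-mono : ∀ (P : Fin n → Bool) → (∀ v → P v ≡ true → f v ≤ g v) → over P f ≤ over P g
over-mono {f = f} {g} P le = sum-mono pointwise
  where
  pointwise : ∀ v → (if P v then f v else 0) ≤ (if P v then g v else 0)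
  pointwise v with P v in Pv
  ... | true  = le v Pv
  ... | false = z≤n

over-+ : ∀ (P : Fin n → Bool) f g → over P (λ v → f v + g v) ≡ over P f + over P g
over-+ P f g = trans (sum-cong pointwise) (sum-+ (λ v → if P v then f v else 0) (λ v → if P v then g v else 0))
  where
  pointwise : ∀ v → (if P v then f v + g v else 0) ≡ (if P v then f v else 0) + (if P v then g v else 0)
  pointwise v with P v
  ... | true  = refl
  ... | false = refl

over-* : ∀ (P : Fin n → Bool) k f → over P (λ v → k * f v) ≡ k * over P f
over-* P k f = trans (sum-cong pointwise) (≡-sym (*-distribˡ-sum +-*-semiring k (λ v → if P v then f v else 0)))
  where
  pointwise : ∀ v → (if P v then k * f v else 0) ≡ k * (if P v then f v else 0)
  pointwise v with P v
  ... | true  = refl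
  ... | false = ≡-sym (*-zeroʳ k)

over-zero : ∀ (P : Fin n → Bool) → (∀ v → P v ≡ true → f v ≡ 0) → over P f ≡ 0
over-zero {n} {f} P eq = trans (sum-cong pointwise) (sum-zero n)
  where
  pointwise : ∀ v → (if P v then f v else 0) ≡ 0
  pointwise v with P v in Pv
  ... | true  = eq v Pv
  ... | false = refl

term≤over : ∀ (P : Fin n → Bool) f {v} → P v ≡ true → f v ≤ over P f
term≤over P f {v} Pv = begin
  f v                           ≡⟨ cong (λ b → if b then f v else 0) Pv ⟨
  (if P v then f v else 0)      ≤⟨ m≤m+n _ _ ⟩
  _                             ≡⟨ sum-at v (λ w → if P w then f w else 0) ⟨
  over P f                      ∎
  where open ≤-Reasoning

without : Fin n → (Fin n → Bool) → Fin n → Bool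
without v P w = not (does (w ≟ v)) ∧ P w

without-∈ : ∀ (v : Fin n) P {w} → without v P w ≡ true → w ≢ v × P w ≡ true
without-∈ v P {w} eq with w ≟ v
... | no w≢v = w≢v , eq

over-at : ∀ (P : Fin n → Bool) f {v} → P v ≡ true → over P f ≡ f v + over (without v P) f
over-at P f {v} Pv = trans (sum-at v _) (cong₂ _+_ (cong (λ b → if b then f v else 0) Pv) (sum-cong rest))
  where
  rest : ∀ w → except v (λ w → if P w then f w else 0) w ≡ (if without v P w then f w else 0)
  rest w with w ≟ v
  ... | yes _ = refl
  ... | no _  = refl

sum-split : ∀ (P : Fin n → Bool) f → sumFin f ≡ over P f + over (not ∘ P) f
sum-split P f = trans (sum-cong pointwise) (sum-+ (λ v → if P v then f v else 0) (λ v → if not (P v) then f v else 0))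
  where
  pointwise : ∀ v → f v ≡ (if P v then f v else 0) + (if not (P v) then f v else 0)
  pointwise v with P v
  ... | true  = ≡-sym (+-identityʳ _)
  ... | false = refl

-- One list serves every `f`: `const 1` determines its length from the degree, and any other `f` is
-- then expanded along it.
enumerate : ∀ {n} (P : Fin n → Bool) →
            ∃ λ vs → All (λ v → P v ≡ true) vs × (∀ f → over P f ≡ sum (map f vs))
enumerate {zero}  P = [] , [] , λ _ → refl
enumerate {suc n} P with enumerate (P ∘ suc) | P zero in P0
... | vs , Pvs , eq | true  = zero ∷ map suc vs , P0 ∷ map⁺ Pvs ,
  λ f → cong (f zero +_) (trans (eq (f ∘ suc)) (cong sum (map-∘ vs)))
... | vs , Pvs , eq | false = map suc vs , map⁺ Pvs ,
  λ f → trans (eq (f ∘ suc)) (cong sum (map-∘ vs))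

-- Symmetric double sums under a change at one vertex.

sumPairs : (Fin n → Fin n → ℕ) → ℕ
sumPairs h = sumFin (λ a → sumFin (h a))

-- By symmetry the row and the column of `v` have equal sums, and they overlap only in the diagonal
-- entry, which is zero.
sumPairs-at : ∀ (v : Fin n) h → (∀ a → h a v ≡ h v a) → h v v ≡ 0 →
              sumPairs h ≡ 2 * sumFin (h v) + sumFin (except v (λ a → sumFin (except v (h a))))
sumPairs-at v h h-sym hvv = begin
  sumPairs h
    ≡⟨ sum-at v (λ a → sumFin (h a)) ⟩
  row + sumFin (except v (λ a → sumFin (h a)))
    ≡⟨ cong (row +_) (sum-cong pointwise) ⟩
  row + sumFin (λ a → except v (h v) a + except v rest a)
    ≡⟨ cong (row +_) (sum-+ (except v (h v)) (except v rest)) ⟩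
  row + (sumFin (except v (h v)) + sumFin (except v rest))
    ≡⟨ cong (λ k → row + (k + sumFin (except v rest))) column ⟨
  row + (row + sumFin (except v rest))
    ≡⟨ double row _ ⟩
  2 * row + sumFin (except v rest)
    ∎
  where
  open ≡-Reasoning
  row = sumFin (h v)
  rest = λ a → sumFin (except v (h a))
  pointwise : ∀ a → except v (λ a → sumFin (h a)) a ≡ except v (h v) a + except v rest a
  pointwise a with a ≟ v
  ... | yes _ = refl
  ... | no _  = trans (sum-at v (h a)) (cong (_+ rest a) (h-sym a))
  column : row ≡ sumFin (except v (h v))
  column = trans (sum-at v (h v)) (cong (_+ sumFin (except v (h v))) hvv)
  double : ∀ a b → a + (a + b) ≡ 2 * a + b
  double = solve-∀

-- Pairs avoiding `v` give the same remainder `r` for both functions, so comparing two energies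
-- reduces to comparing the rows of `v`.
sumPairs-change : ∀ (v : Fin n) h h′ →
  (∀ a → h a v ≡ h v a) → (∀ a → h′ a v ≡ h′ v a) → h v v ≡ 0 → h′ v v ≡ 0 →
  (∀ a b → a ≢ v → b ≢ v → h a b ≡ h′ a b) →
  ∃ λ r → sumPairs h ≡ 2 * sumFin (h v) + r × sumPairs h′ ≡ 2 * sumFin (h′ v) + r
sumPairs-change v h h′ h-sym h′-sym hvv h′vv agree =
  _ , trans (sumPairs-at v h h-sym hvv) (cong (2 * sumFin (h v) +_) (sum-cong
        (except-cong v λ a a≢v → sum-cong (except-cong v λ b b≢v → agree a b a≢v b≢v)))) ,
  sumPairs-at v h′ h′-sym h′vv

-- Locally maximal cuts.

𝟙 : Bool → ℕ
𝟙 b = if b then 1 else 0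

same : Bool → Bool → Bool
same a b = not (a xor b)

same-sym : ∀ a b → same a b ≡ same b a
same-sym false false = refl
same-sym false true  = refl
same-sym true  false = refl
same-sym true  true  = refl

same-not : ∀ a b → same (not a) b ≡ not (same a b)
same-not false b = refl
same-not true  b = ≡-sym (not-involutive (not b))

-- Used twice: on all edges, to obtain the two sides, and on the monochromatic edges, to obtain a
-- first choice of one end of each.
module Cut {n} (W : Fin n → Fin n → Bool) (W-sym : ∀ a b → W a b ≡ W b a) (W-irrefl : ∀ a → W a a ≡ false) where

  W⇒≢ : ∀ {a b} → W a b ≡ true → b ≢ a
  W⇒≢ {a} Wab refl with trans (≡-sym Wab) (W-irrefl a)
  ... | ()

  within across : (Fin n → Bool) → Fin n → ℕ
  within c u = over (W u) (λ w → 𝟙 (same (c u) (c w)))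
  across c u = over (W u) (λ w → 𝟙 (not (same (c u) (c w))))

  private
    mono : (Fin n → Bool) → Fin n → Fin n → ℕ
    mono c a b = if W a b then 𝟙 (same (c a) (c b)) else 0

    mono-sym : ∀ c a b → mono c a b ≡ mono c b a
    mono-sym c a b = cong₂ (λ e s → if e then 𝟙 s else 0) (W-sym a b) (same-sym (c a) (c b))

    mono-diag : ∀ c a → mono c a a ≡ 0
    mono-diag c a rewrite W-irrefl a = refl

    -- Flipping `v` exchanges its numbers of neighbours within and across, and changes no pair that
    -- avoids `v`.
    step : ∀ c → (∀ u → within c u ≤ across c u) ⊎ ∃ λ c′ → sumPairs (mono c′) < sumPairs (mono c)
    step c with any? (λ v → across c v <? within c v)
    ... | no none = inj₁ (λ u → ≮⇒≥ (λ lt → none (u , lt)))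
    ... | yes (v , lt) = inj₂ (c′ , less)
      where
      c′ = updateAt c v not
      flip : over (W v) (λ w → 𝟙 (same (c′ v) (c′ w))) ≡ across c v
      flip = over-cong (W v) λ w Wvw → cong 𝟙 (trans
        (cong₂ same (updateAt-updates v c) (updateAt-minimal w v c (W⇒≢ Wvw)))
        (same-not (c v) (c w)))
      agree : ∀ a b → a ≢ v → b ≢ v → mono c′ a b ≡ mono c a b
      agree a b a≢v b≢v = cong₂ (λ x y → if W a b then 𝟙 (same x y) else 0)
        (updateAt-minimal a v c a≢v) (updateAt-minimal b v c b≢v)
      less : sumPairs (mono c′) < sumPairs (mono c)
      less with sumPairs-change v (mono c′) (mono c) (λ a → mono-sym c′ a v) (λ a → mono-sym c a v)
                  (mono-diag c′ v) (mono-diag c v) agree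
      ... | r , E′ , E = subst₂ _<_ (≡-sym (trans E′ (cong (λ k → 2 * k + r) flip))) (≡-sym E)
              (+-monoˡ-< r (*-monoʳ-< 2 lt))

  abstract
    locallyMaximalCut : ∃ λ c → ∀ u → within c u ≤ across c u
    locallyMaximalCut = descend (λ c → sumPairs (mono c)) step (const false)

  within+across : ∀ c u → within c u + across c u ≡ over (W u) (const 1)
  within+across c u = trans (≡-sym (over-+ (W u) _ _)) (over-cong (W u) (λ w _ → total (same (c u) (c w))))
    where
    total : ∀ b → 𝟙 b + 𝟙 (not b) ≡ 1
    total true  = refl
    total false = refl

-- Choosing one end of each monochromatic edge.

module Selection {n} (S O : Fin n → Fin n → Bool)
  (S-sym : ∀ a b → S a b ≡ S b a) (S-irrefl : ∀ a → S a a ≡ false)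
  (O-sym : ∀ a b → O a b ≡ O b a) (O-irrefl : ∀ a → O a a ≡ false)
  (disjoint : ∀ {a b} → S a b ≡ true → O a b ≡ false)
  (atMostOne : ∀ u → over (S u) (const 1) ≤ 1) where

  private
    module CS = Cut S S-sym S-irrefl
    module CO = Cut O O-sym O-irrefl

  mate-unique : ∀ {u a b} → S u a ≡ true → S u b ≡ true → b ≡ a
  mate-unique {u} {a} {b} Sua Sub with b ≟ a
  ... | yes b≡a = b≡a
  -- Two distinct mates would contribute 2 to a sum that is at most 1.
  ... | no  b≢a = contradiction (≤-trans (+-monoʳ-≤ 1 (term≤over (without a (S u)) (const 1) in-rest))
                                   (subst (_≤ 1) (over-at (S u) (const 1) Sua) (atMostOne u))) (λ { (s≤s ()) })
    where
    in-rest : without a (S u) b ≡ true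
    in-rest with b ≟ a
    ... | yes b≡a = contradiction b≡a b≢a
    ... | no _    = Sub

  -- `onlyMated` later guarantees that a chosen vertex has a mate, hence exactly one, and that it is
  -- not movable.
  record Transversal (p : Fin n → Bool) : Set where
    field
      exactlyOne : ∀ {a b} → S a b ≡ true → p b ≡ not (p a)
      onlyMated  : ∀ {a} → p a ≡ true → ∃ λ b → S a b ≡ true
  open Transversal public

  load : (Fin n → Bool) → Fin n → ℕ
  load p u = over (O u) (𝟙 ∘ p)

  private
    mated? : ∀ u → Dec (∃ λ b → S u b ≡ true)
    mated? u = any? (λ b → S u b ≟ᵇ true)

    -- In a graph of maximum degree 1 a locally maximal cut is a proper 2-colouring; one colour
    -- class, restricted to the mated vertices, is a transversal.
    initial : ∃ Transversal
    initial with CS.locallyMaximalCut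
    ... | q , q-max = (λ u → does (mated? u) ∧ q u) , record { exactlyOne = one ; onlyMated = mated }
      where
      proper : ∀ {a b} → S a b ≡ true → same (q a) (q b) ≡ false
      proper {a} {b} Sab with same (q a) (q b) in eq
      ... | false = refl
      -- An edge within the cut gives 1 ≤ within ≤ across at `a`, hence two mates.
      ... | true  = contradiction (≤-trans (+-mono-≤ 1≤w (≤-trans 1≤w (q-max a)))
                      (subst (_≤ 1) (≡-sym (CS.within+across q a)) (atMostOne a))) (λ { (s≤s ()) })
        where
        1≤w : 1 ≤ CS.within q a
        1≤w = subst (_≤ CS.within q a) (cong 𝟙 eq) (term≤over (S a) (λ w → 𝟙 (same (q a) (q w))) Sab)
      distinct : ∀ x y → same x y ≡ false → y ≡ not x
      distinct false true  _ = refl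
      distinct true  false _ = refl
      one : ∀ {a b} → S a b ≡ true → does (mated? b) ∧ q b ≡ not (does (mated? a) ∧ q a)
      one {a} {b} Sab rewrite dec-true (mated? a) (b , Sab)
                            | dec-true (mated? b) (a , trans (S-sym b a) Sab) = distinct _ _ (proper Sab)
      mated : ∀ {a} → does (mated? a) ∧ q a ≡ true → ∃ λ b → S a b ≡ true
      mated {a} eq with mated? a
      ... | yes m = m

    both : (Fin n → Bool) → Fin n → Fin n → ℕ
    both p a b = if O a b then 𝟙 (p a ∧ p b) else 0

    both-sym : ∀ p a b → both p a b ≡ both p b a
    both-sym p a b = cong₂ (λ e s → if e then 𝟙 s else 0) (O-sym a b) (∧-comm (p a) (p b))

    both-diag : ∀ p a → both p a a ≡ 0
    both-diag p a rewrite O-irrefl a = refl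

    energy : (Fin n → Bool) → ℕ
    energy p = sumPairs (both p)

    -- The new pairs are the `O`-edges from `v` to chosen vertices, each counted in both orders.
    -- Since `p⁺` is given only by its values, the lemma also reads backwards as the removal of `v`.
    insert : ∀ v {p p⁺} → p v ≡ false → p⁺ v ≡ true → (∀ a → a ≢ v → p⁺ a ≡ p a) →
             energy p⁺ ≡ 2 * load p v + energy p
    insert v {p} {p⁺} pv p⁺v agree with sumPairs-change v (both p⁺) (both p)
        (λ a → both-sym p⁺ a v) (λ a → both-sym p a v) (both-diag p⁺ v) (both-diag p v)
        (λ a b a≢v b≢v → cong₂ (λ x y → if O a b then 𝟙 (x ∧ y) else 0) (agree a a≢v) (agree b b≢v))
    ... | r , E⁺ , E = trans E⁺ (cong₂ (λ k l → 2 * k + l) row⁺ (≡-sym (trans E (cong (λ k → 2 * k + r) row))))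
      where
      row⁺ : over (O v) (λ b → 𝟙 (p⁺ v ∧ p⁺ b)) ≡ load p v
      row⁺ = over-cong (O v) λ b Ovb → cong₂ (λ x y → 𝟙 (x ∧ y)) p⁺v (agree b (CO.W⇒≢ Ovb))
      row : over (O v) (λ b → 𝟙 (p v ∧ p b)) ≡ 0
      row = over-zero (O v) λ b _ → cong (λ x → 𝟙 (x ∧ p b)) pv

    Balanced : (Fin n → Bool) → Set
    Balanced p = ∀ {u w} → S u w ≡ true → p u ≡ true → load p u ≤ load p w

    -- The exchange passes through `p°`, in which neither end is chosen: dropping `u` saves twice
    -- its load, and adding `w` costs twice the smaller load of `w`.
    swap : ∀ p → Transversal p → ∀ {u w} → S u w ≡ true → p u ≡ true → load p w < load p u →
           ∃ λ p′ → Transversal p′ × energy p′ < energy p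
    swap p tr {u} {w} Suw pu lt = p′ , record { exactlyOne = one ; onlyMated = mated } , less
      where
      p° p′ : Fin n → Bool
      p° = updateAt p u (const false)
      p′ = updateAt p° w (const true)
      Swu = trans (S-sym w u) Suw
      w≢u = CS.W⇒≢ Suw
      u≢w : u ≢ w
      u≢w = w≢u ∘ ≡-sym
      p°u : p° u ≡ false
      p°u = updateAt-updates u p
      p′w : p′ w ≡ true
      p′w = updateAt-updates w p°
      p′u : p′ u ≡ false
      p′u = trans (updateAt-minimal u w p° u≢w) p°u
      p°w : p° w ≡ false
      p°w = trans (updateAt-minimal w u p w≢u) (trans (exactlyOne tr Suw) (cong not pu))
      p°≡p : ∀ a → a ≢ u → p° a ≡ p a
      p°≡p a = updateAt-minimal a u p
      p′≡p : ∀ a → a ≢ u → a ≢ w → p′ a ≡ p a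
      p′≡p a a≢u a≢w = trans (updateAt-minimal a w p° a≢w) (p°≡p a a≢u)
      one : ∀ {a b} → S a b ≡ true → p′ b ≡ not (p′ a)
      one {a} {b} Sab with a ≟ u | a ≟ w
      ... | yes refl | _ rewrite mate-unique Suw Sab = trans p′w (cong not (≡-sym p′u))
      ... | no _ | yes refl rewrite mate-unique Swu Sab = trans p′u (cong not (≡-sym p′w))
      -- If `b` were `u` or `w`, uniqueness of mates would make `a` the other one.
      ... | no a≢u | no a≢w = trans (p′≡p b (λ { refl → a≢w (mate-unique Suw Sba) })
                                           (λ { refl → a≢u (mate-unique Swu Sba) }))
                                (trans (exactlyOne tr Sab) (cong not (≡-sym (p′≡p a a≢u a≢w))))
        where Sba = trans (S-sym b a) Sab
      mated : ∀ {a} → p′ a ≡ true → ∃ λ b → S a b ≡ true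
      mated {a} eq with a ≟ u | a ≟ w
      ... | yes refl | _       = w , Suw
      ... | no _ | yes refl    = u , Swu
      ... | no a≢u | no a≢w = onlyMated tr (trans (≡-sym (p′≡p a a≢u a≢w)) eq)
      load-u : load p° u ≡ load p u
      load-u = over-cong (O u) λ b Oub → cong 𝟙 (p°≡p b (CO.W⇒≢ Oub))
      load-w : load p° w ≡ load p w
      -- Dropping `u` does not affect the load of `w`, since an `S`-edge is not an `O`-edge.
      load-w = over-cong (O w) λ b Owb → cong 𝟙 (p°≡p b λ { refl → contradiction (trans (≡-sym Owb) (disjoint Swu)) λ () })
      less : energy p′ < energy p
      less = begin-strict
        energy p′                     ≡⟨ insert w p°w p′w (λ a → updateAt-minimal a w p°) ⟩
        2 * load p° w + energy p°     ≡⟨ cong (λ k → 2 * k + energy p°) load-w ⟩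
        2 * load p w + energy p°      <⟨ +-monoˡ-< (energy p°) (*-monoʳ-< 2 lt) ⟩
        2 * load p u + energy p°      ≡⟨ cong (λ k → 2 * k + energy p°) load-u ⟨
        2 * load p° u + energy p°     ≡⟨ insert u p°u pu (λ a a≢u → ≡-sym (p°≡p a a≢u)) ⟨
        energy p                      ∎
        where open ≤-Reasoning

    step : ∀ (t : ∃ Transversal) → Balanced (proj₁ t) ⊎ ∃ λ t′ → energy (proj₁ t′) < energy (proj₁ t)
    step (p , tr) with any? (λ u → any? (λ w →
                         S u w ≟ᵇ true ×-dec p u ≟ᵇ true ×-dec load p w <? load p u))
    ... | no none = inj₁ (λ Suw pu → ≮⇒≥ (λ lt → none (_ , _ , Suw , pu , lt)))
    ... | yes (u , w , Suw , pu , lt) with swap p tr Suw pu lt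
    ...   | p′ , tr′ , less = inj₂ ((p′ , tr′) , less)

  abstract
    balancedTransversal : ∃ λ p → Transversal p × (∀ {u w} → S u w ≡ true → p u ≡ true → load p u ≤ load p w)
    balancedTransversal with descend (λ t → energy (proj₁ t)) step initial
    ... | (p , tr) , balanced = p , tr , balanced

-- Which values a single neighbour forbids.

-- The condition that `z` is the mean of three values with sum `s`, multiplied by 3 to avoid
-- division.
bad : ℕ → Bool → Fin 4 → Bool
bad s movable z = movable ∧ (s ≡ᵇ 3 * toℕ z)

tripleSum : Fin 4 → Fin 4 → Fin 4 → ℕ
tripleSum t z z′ = toℕ t + (toℕ z + toℕ z′)

-- The value `t` belongs to the vertex being moved, so its flag is always `true`; `b` and `b′` tell
-- whether the other two neighbours are movable.
tripleCost : Fin 4 → Bool → Bool → Fin 4 → Fin 4 → ℕ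
tripleCost t b b′ z z′ = 𝟙 (bad s true t) + (𝟙 (bad s b z) + 𝟙 (bad s b′ z′))
  where s = tripleSum t z z′

mid : Fin 4 → Bool
mid t = (toℕ t ≡ᵇ 1) ∨ (toℕ t ≡ᵇ 2)

-- The kinds 0, …, 3 forbid at most that one value, kind 4 forbids exactly 0 and 3.
blocks : Fin 5 → Fin 4 → Bool
blocks 4F t = not (mid t)
blocks k  t = toℕ k ≡ᵇ toℕ t

-- The exceptional situation in which both 0 and 3 are forbidden. `zero≡1` bounds the price of
-- choosing 0 nevertheless; `midBad` places a conflict on a neighbour of value 1 or 2.
record Double (b b′ : Bool) (z z′ : Fin 4) : Set where
  constructor double
  field
    midˡ    : mid z ≡ true
    midʳ    : mid z′ ≡ true
    zero≡1  : tripleCost 0F b b′ z z′ ≡ 1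
    midBad  : ∀ t → mid t ≡ false → bad (tripleSum t z z′) b z ≡ true ⊎ bad (tripleSum t z z′) b′ z′ ≡ true
open Double

double? : ∀ b b′ z z′ → Dec (Double b b′ z z′)
double? b b′ z z′ = map′ (λ (a , b , c , d) → double a b c d) (λ (double a b c d) → a , b , c , d)
  (mid z ≟ᵇ true ×-dec mid z′ ≟ᵇ true ×-dec tripleCost 0F b b′ z z′ ≟ⁿ 1 ×-dec
   all? (λ t → mid t ≟ᵇ false →-dec
     (bad (tripleSum t z z′) b z ≟ᵇ true ⊎-dec bad (tripleSum t z z′) b′ z′ ≟ᵇ true)))

Classified : Bool → Bool → Fin 4 → Fin 4 → Set
Classified b b′ z z′ = ∃ λ k → (∀ t → blocks k t ≡ false → tripleCost t b b′ z z′ ≡ 0) ×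
                               (k ≡ 4F → Double b b′ z z′)

classified? : ∀ b b′ z z′ → Dec (Classified b b′ z z′)
classified? b b′ z z′ = any? λ k →
  all? (λ t → blocks k t ≟ᵇ false →-dec tripleCost t b b′ z z′ ≟ⁿ 0) ×-dec
  (k ≟ 4F →-dec double? b b′ z z′)

abstract
  -- One of three numbers is their mean exactly when they form an arithmetic progression in some
  -- order, so `t` is forbidden only if it completes `z` and `z′` to one. Within 0, ..., 3 only the
  -- pair 1, 2 has two completions, namely 0 and 3. The proof checks all cases by evaluation.
  classify : ∀ b b′ z z′ → Classified b b′ z z′
  classify false false = from-yes (all? λ z → all? λ z′ → classified? false false z z′)
  classify false true  = from-yes (all? λ z → all? λ z′ → classified? false true z z′)
  classify true  false = from-yes (all? λ z → all? λ z′ → classified? true false z z′)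
  classify true  true  = from-yes (all? λ z → all? λ z′ → classified? true true z z′)

Free : Fin 5 → Fin 4 → Set
Free k t = blocks k t ≡ false

abstract
  -- Three kinds forbidding one value each cannot exhaust four values. With kind 4 present, all
  -- values are exhausted only if the other two kinds forbid 1 and 2, and then both of these are
  -- free at 0.
  freeOrDouble : ∀ k₁ k₂ k₃ →
    (∃ λ t → Free k₁ t × Free k₂ t × Free k₃ t) ⊎
    (k₁ ≡ 4F × Free k₂ 0F × Free k₃ 0F) ⊎
    (k₂ ≡ 4F × Free k₁ 0F × Free k₃ 0F) ⊎
    (k₃ ≡ 4F × Free k₁ 0F × Free k₂ 0F)
  freeOrDouble = from-yes (all? λ k₁ → all? λ k₂ → all? λ k₃ →
    any? (λ t → free? k₁ t ×-dec free? k₂ t ×-dec free? k₃ t) ⊎-dec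
    (k₁ ≟ 4F ×-dec free? k₂ 0F ×-dec free? k₃ 0F) ⊎-dec
    (k₂ ≟ 4F ×-dec free? k₁ 0F ×-dec free? k₃ 0F) ⊎-dec
    (k₃ ≟ 4F ×-dec free? k₁ 0F ×-dec free? k₂ 0F))
    where
    free? : ∀ k t → Dec (Free k t)
    free? k t = blocks k t ≟ᵇ false

-- Values avoiding the means around neighbours.

-- `fixed` depends on the centre `u` as well, because a neighbour may count differently around
-- different centres.
module MeanFree {n} (G : Graph n) (cubic : Cubic G) (movable : Fin n → Bool) (fixed : Fin n → Fin n → Fin 4) where

  value : (Fin n → Fin 4) → Fin n → Fin n → Fin 4
  value y u w = if movable w then y w else fixed u w

  total : (Fin n → Fin 4) → Fin n → ℕ
  total y u = over (adj G u) (λ w → toℕ (value y u w))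

  private
    badAt : (Fin n → Fin 4) → Fin n → Fin n → Bool
    badAt y u w = bad (total y u) (movable w) (value y u w)

    cost : (Fin n → Fin 4) → Fin n → ℕ
    cost y u = over (adj G u) (𝟙 ∘ badAt y u)

    record Neighbours (v : Fin n) : Set where
      constructor triple
      field
        {a b c} : Fin n
        va     : adj G v a ≡ true
        vb     : adj G v b ≡ true
        vc     : adj G v c ≡ true
        expand : ∀ f → over (adj G v) f ≡ f a + (f b + f c)

    record OtherNeighbours (u v : Fin n) : Set where
      constructor pair
      field
        {a b}  : Fin n
        a≢v    : a ≢ v
        b≢v    : b ≢ v
        ua     : adj G u a ≡ true
        ub     : adj G u b ≡ true
        expand : ∀ f → over (adj G u) f ≡ f v + (f a + f b)

    abstract
      neighbours : ∀ v → Neighbours v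
      neighbours v with enumerate (adj G v)
      ... | vs , adjs , eq = shape vs adjs eq (trans (≡-sym (eq (const 1))) (cubic v))
        where
        shape : ∀ vs → All (λ w → adj G v w ≡ true) vs → (∀ f → over (adj G v) f ≡ sum (map f vs)) →
                sum (map (const 1) vs) ≡ 3 → Neighbours v
        -- The sum of ones being 3 rules out lists of any other length.
        shape (a ∷ b ∷ c ∷ []) (va ∷ vb ∷ vc ∷ []) eq _ = triple va vb vc
          λ f → trans (eq f) (cong (λ k → f a + (f b + k)) (+-identityʳ (f c)))

      otherNeighbours : ∀ {u v} → adj G u v ≡ true → OtherNeighbours u v
      otherNeighbours {u} {v} uv with enumerate (without v (adj G u))
      ... | vs , ins , eq = shape vs ins eq (suc-injective (trans (≡-sym (cong suc (eq (const 1))))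
                              (trans (≡-sym (over-at (adj G u) (const 1) uv)) (cubic u))))
        where
        shape : ∀ vs → All (λ w → without v (adj G u) w ≡ true) vs →
                (∀ f → over (without v (adj G u)) f ≡ sum (map f vs)) → sum (map (const 1) vs) ≡ 2 →
                OtherNeighbours u v
        shape (a ∷ b ∷ []) (ia ∷ ib ∷ []) eq _ with without-∈ v (adj G u) ia | without-∈ v (adj G u) ib
        ... | a≢v , ua | b≢v , ub = pair a≢v b≢v ua ub λ f →
          trans (over-at (adj G u) f uv) (cong (f v +_) (trans (eq f) (cong (f a +_) (+-identityʳ (f b)))))

    AgreeOff : Fin n → (Fin n → Fin 4) → (Fin n → Fin 4) → Set
    AgreeOff v y′ y = ∀ w → w ≢ v → y′ w ≡ y w

    value-cong : ∀ y y′ u w → y′ w ≡ y w → value y′ u w ≡ value y u w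
    value-cong y y′ u w eq = cong (λ z → if movable w then z else fixed u w) eq

    value-movable : ∀ y u {w} → movable w ≡ true → value y u w ≡ y w
    value-movable y u {w} mw = cong (λ b → if b then y w else fixed u w) mw

    -- The values `z` and `z′` are read from `y`, but the formulas hold for every `y′` that agrees
    -- with `y` off `v`; one classification of `u` thus serves `y` and all moves of `v`.
    module Around (y : Fin n → Fin 4) {u v : Fin n} (uv : adj G u v ≡ true) (mv : movable v ≡ true) where
      open OtherNeighbours (otherNeighbours uv) public

      z z′ : Fin 4
      z  = value y u a
      z′ = value y u b

      costOf : Fin 4 → ℕ
      costOf t = tripleCost t (movable a) (movable b) z z′

      total≡ : ∀ y′ → AgreeOff v y′ y → total y′ u ≡ tripleSum (y′ v) z z′
      total≡ y′ agree = trans (expand _) (cong₂ _+_ (cong toℕ (value-movable y′ u mv))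
        (cong₂ (λ p q → toℕ p + toℕ q) (value-cong y y′ u a (agree a a≢v)) (value-cong y y′ u b (agree b b≢v))))

      cost≡ : ∀ y′ → AgreeOff v y′ y → cost y′ u ≡ costOf (y′ v)
      cost≡ y′ agree = trans (expand _) (trans
        (cong (λ s → 𝟙 (bad s (movable v) (value y′ u v)) +
                     (𝟙 (bad s (movable a) (value y′ u a)) + 𝟙 (bad s (movable b) (value y′ u b)))) (total≡ y′ agree))
        (cong₂ (λ p q → p + q)
          (cong₂ (λ m t → 𝟙 (bad s m t)) mv (value-movable y′ u mv))
          (cong₂ (λ p q → 𝟙 (bad s (movable a) p) + 𝟙 (bad s (movable b) q))
            (value-cong y y′ u a (agree a a≢v)) (value-cong y y′ u b (agree b b≢v)))))
        where s = tripleSum (y′ v) z z′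

      classified : Classified (movable a) (movable b) z z′
      classified = classify (movable a) (movable b) z z′

      kind : Fin 5
      kind = proj₁ classified

      free : ∀ t → Free kind t → costOf t ≡ 0
      free = proj₁ (proj₂ classified)

      isDouble : kind ≡ 4F → Double (movable a) (movable b) z z′
      isDouble = proj₂ (proj₂ classified)

    Conflicted : (Fin n → Fin 4) → Fin n → Set
    Conflicted y v = movable v ≡ true × ∃ λ u → adj G u v ≡ true × badAt y u v ≡ true

    bad⇒movable : ∀ s m z → bad s m z ≡ true → m ≡ true
    bad⇒movable s true z _ = refl

    -- With values 1 and 2, a third value 0 has mean 1 and a third value 3 has mean 2.
    midConflict : ∀ y {u v} (uv : adj G u v ≡ true) (mv : movable v ≡ true) → let open Around y uv mv in
                  kind ≡ 4F → mid (y v) ≡ false → ∃ λ w → Conflicted y w × mid (y w) ≡ true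
    midConflict y {u} {v} uv mv k≡4 mid≡false with midBad (isDouble k≡4) (y v) mid≡false
      where open Around y uv mv
    ... | inj₁ bad-a = a , (ma , u , ua , trans (cong (λ s → bad s (movable a) z) (total≡ y λ _ _ → refl)) bad-a) ,
                       trans (cong mid (≡-sym (value-movable y u ma))) (midˡ (isDouble k≡4))
      where
      open Around y uv mv
      ma = bad⇒movable (tripleSum (y v) z z′) (movable a) z bad-a
    ... | inj₂ bad-b = b , (mb , u , ub , trans (cong (λ s → bad s (movable b) z′) (total≡ y λ _ _ → refl)) bad-b) ,
                       trans (cong mid (≡-sym (value-movable y u mb))) (midʳ (isDouble k≡4))
      where
      open Around y uv mv
      mb = bad⇒movable (tripleSum (y v) z z′) (movable b) z′ bad-b

    -- The factor 2 lets a move that removes a conflict pay for a new value 1 or 2.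
    energy : (Fin n → Fin 4) → ℕ
    energy y = 2 * sumFin (cost y) + sumFin (λ w → 𝟙 (mid (y w)))

    local : (Fin n → Fin 4) → Fin n → ℕ
    local y v = over (adj G v) (cost y)

    -- Only neighbours of `v` see its value, so the costs at all other vertices and the penalties
    -- away from `v` cancel.
    energy-local : ∀ v {y y′} → AgreeOff v y′ y → 
      2 * local y′ v + 𝟙 (mid (y′ v)) < 2 * local y v + 𝟙 (mid (y v)) → energy y′ < energy y
    energy-local v {y} {y′} agree lt = begin-strict
      energy y′                                            ≡⟨ split y′ ⟩
      2 * local y′ v + 𝟙 (mid (y′ v)) + rest y′            ≡⟨ cong (2 * local y′ v + 𝟙 (mid (y′ v)) +_) rest≡ ⟩
      2 * local y′ v + 𝟙 (mid (y′ v)) + rest y             <⟨ +-monoˡ-< (rest y) lt ⟩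
      2 * local y v + 𝟙 (mid (y v)) + rest y               ≡⟨ split y ⟨
      energy y                                             ∎
      where
      open ≤-Reasoning
      rest : (Fin n → Fin 4) → ℕ
      rest y = 2 * over (not ∘ adj G v) (cost y) + sumFin (except v (λ w → 𝟙 (mid (y w))))
      regroup : ∀ a b c d → 2 * (a + b) + (c + d) ≡ 2 * a + c + (2 * b + d)
      regroup = solve-∀
      split : ∀ y → energy y ≡ 2 * local y v + 𝟙 (mid (y v)) + rest y
      split y = trans (cong₂ (λ p q → 2 * p + q) (sum-split (adj G v) (cost y)) (sum-at v (λ w → 𝟙 (mid (y w)))))
                      (regroup (local y v) _ _ _)
      far : ∀ u → not (adj G v u) ≡ true → cost y′ u ≡ cost y u
      far u nvu = trans
        (cong (λ s → over (adj G u) (λ w → 𝟙 (bad s (movable w) (value y′ u w)))) total≡)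
        (over-cong (adj G u) λ w uw → cong (λ z → 𝟙 (bad (total y u) (movable w) z)) (value≡ w uw))
        where
        value≡ : ∀ w → adj G u w ≡ true → value y′ u w ≡ value y u w
        value≡ w uw = value-cong y y′ u w (agree w λ { refl →
          contradiction (trans (≡-sym nvu) (cong not (trans (Graph.sym G v u) uw))) λ () })
        total≡ : total y′ u ≡ total y u
        total≡ = over-cong (adj G u) λ w uw → cong toℕ (value≡ w uw)
      rest≡ : rest y′ ≡ rest y
      rest≡ = cong₂ (λ p q → 2 * p + q) (over-cong (not ∘ adj G v) far)
                (sum-cong (except-cong v λ w w≢v → cong (𝟙 ∘ mid) (agree w w≢v)))

    Improvable : (Fin n → Fin 4) → Set
    Improvable y = ∃ λ y′ → energy y′ < energy y

    -- If some value is free around all three neighbours, `v` moves there. Otherwise one neighbour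
    -- is exceptional and 0 creates exactly one conflict: moving to 0 pays off if `v` carries a
    -- penalty, and if not, the exceptional neighbour shows a conflict at a penalised vertex.
    resolve : ∀ y v → Conflicted y v → Improvable y ⊎
              (mid (y v) ≡ false × ∃ λ w → Conflicted y w × mid (y w) ≡ true)
    resolve y v (mv , u , uv , bad-uv) with neighbours v
    ... | triple {u₁} {u₂} {u₃} vu₁ vu₂ vu₃ expand = cases (freeOrDouble N₁.kind N₂.kind N₃.kind)
      where
      flip : ∀ {w} → adj G v w ≡ true → adj G w v ≡ true
      flip {w} vw = trans (Graph.sym G w v) vw
      module N₁ = Around y (flip vu₁) mv
      module N₂ = Around y (flip vu₂) mv
      module N₃ = Around y (flip vu₃) mv

      move : Fin 4 → Fin n → Fin 4
      move t = updateAt y v (const t)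

      move-off : ∀ t → AgreeOff v (move t) y
      move-off t w = updateAt-minimal w v y

      move-at : ∀ t → move t v ≡ t
      move-at t = updateAt-updates v y

      local-move : ∀ t → local (move t) v ≡ N₁.costOf t + (N₂.costOf t + N₃.costOf t)
      local-move t = trans (expand (cost (move t))) (subst
        (λ s → cost (move t) u₁ + (cost (move t) u₂ + cost (move t) u₃) ≡ N₁.costOf s + (N₂.costOf s + N₃.costOf s))
        (move-at t)
        (cong₂ _+_ (N₁.cost≡ (move t) (move-off t)) (cong₂ _+_ (N₂.cost≡ (move t) (move-off t)) (N₃.cost≡ (move t) (move-off t)))))

      conflicted : 1 ≤ local y v
      conflicted = ≤-trans (subst (_≤ cost y u) (cong 𝟙 bad-uv) (term≤over (adj G u) (𝟙 ∘ badAt y u) uv))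
                           (term≤over (adj G v) (cost y) (trans (Graph.sym G v u) uv))

      𝟙≤1 : ∀ b → 𝟙 b ≤ 1
      𝟙≤1 true  = s≤s z≤n
      𝟙≤1 false = z≤n

      -- At least one conflict, of weight 2, disappears, while the penalty at `v` is at most 1.
      toFree : ∀ t → Free N₁.kind t → Free N₂.kind t → Free N₃.kind t → Improvable y
      toFree t f₁ f₂ f₃ = move t , energy-local v (move-off t) (begin-strict
        2 * local (move t) v + 𝟙 (mid (move t v))   ≡⟨ cong (λ k → 2 * k + _) (trans (local-move t)
                                                        (cong₂ _+_ (N₁.free t f₁) (cong₂ _+_ (N₂.free t f₂) (N₃.free t f₃)))) ⟩
        𝟙 (mid (move t v))                          ≤⟨ 𝟙≤1 _ ⟩
        1                                           <⟨ *-monoʳ-≤ 2 conflicted ⟩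
        2 * local y v                               ≤⟨ m≤m+n _ _ ⟩
        2 * local y v + 𝟙 (mid (y v))               ∎)
        where open ≤-Reasoning

      -- The conflict cost does not grow, as at least one conflict was present, and the penalty at
      -- `v` drops from 1 to 0.
      toZero : N₁.costOf 0F + (N₂.costOf 0F + N₃.costOf 0F) ≡ 1 → mid (y v) ≡ true → Improvable y
      toZero cost1 mid-v = move 0F , energy-local v (move-off 0F) (begin-strict
        2 * local (move 0F) v + 𝟙 (mid (move 0F v))   ≡⟨ cong₂ (λ k t → 2 * k + 𝟙 (mid t)) (trans (local-move 0F) cost1) (move-at 0F) ⟩
        2                                             ≤⟨ *-monoʳ-≤ 2 conflicted ⟩
        2 * local y v                                 <⟨ m<m+n (2 * local y v) (s≤s z≤n) ⟩
        2 * local y v + 1                             ≡⟨ cong (λ b → 2 * local y v + 𝟙 b) mid-v ⟨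
        2 * local y v + 𝟙 (mid (y v))                 ∎)
        where
        open ≤-Reasoning

      viaDouble : ∀ {w} (vw : adj G v w ≡ true) → Around.kind y (flip vw) mv ≡ 4F →
                  N₁.costOf 0F + (N₂.costOf 0F + N₃.costOf 0F) ≡ 1 →
                  Improvable y ⊎ (mid (y v) ≡ false × ∃ λ w → Conflicted y w × mid (y w) ≡ true)
      viaDouble vw k≡4 cost1 with mid (y v) in mid-v
      ... | true  = inj₁ (toZero cost1 mid-v)
      ... | false = inj₂ (refl , midConflict y (flip vw) mv k≡4 mid-v)

      cases : _ → Improvable y ⊎ (mid (y v) ≡ false × ∃ λ w → Conflicted y w × mid (y w) ≡ true)
      cases (inj₁ (t , f₁ , f₂ , f₃)) = inj₁ (toFree t f₁ f₂ f₃)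
      cases (inj₂ (inj₁ (k≡4 , f₂ , f₃))) = viaDouble vu₁ k≡4
        (cong₂ _+_ (zero≡1 (N₁.isDouble k≡4)) (cong₂ _+_ (N₂.free 0F f₂) (N₃.free 0F f₃)))
      cases (inj₂ (inj₂ (inj₁ (k≡4 , f₁ , f₃)))) = viaDouble vu₂ k≡4
        (cong₂ _+_ (N₁.free 0F f₁) (cong₂ _+_ (zero≡1 (N₂.isDouble k≡4)) (N₃.free 0F f₃)))
      cases (inj₂ (inj₂ (inj₂ (k≡4 , f₁ , f₂)))) = viaDouble vu₃ k≡4
        (cong₂ _+_ (N₁.free 0F f₁) (cong₂ _+_ (N₂.free 0F f₂) (zero≡1 (N₃.isDouble k≡4))))

    -- Two attempts suffice: the vertex `w` returned by a failed one is penalised, which excludes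
    -- failure at `w`.
    improve : ∀ y v → Conflicted y v → Improvable y
    improve y v conf with resolve y v conf
    ... | inj₁ better = better
    ... | inj₂ (_ , w , conf-w , mid-w) with resolve y w conf-w
    ...   | inj₁ better = better
    ...   | inj₂ (mid-w≡false , _) = contradiction (trans (≡-sym mid-w) mid-w≡false) λ ()

  abstract
    meanFree : ∃ λ y → ∀ {u v} → adj G u v ≡ true → movable v ≡ true → total y u ≢ 3 * toℕ (y v)
    meanFree = descend energy step (const 0F)
      where
      step : ∀ y → (∀ {u v} → adj G u v ≡ true → movable v ≡ true → total y u ≢ 3 * toℕ (y v)) ⊎
                   Improvable y
      step y with any? (λ v → any? (λ u → movable v ≟ᵇ true ×-dec adj G u v ≟ᵇ true ×-dec total y u ≟ⁿ 3 * toℕ (y v)))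
      ... | no none = inj₁ λ uv mv eq → none (_ , _ , mv , uv , eq)
      ... | yes (v , u , mv , uv , eq) = inj₂ (improve y v (mv , u , uv , isBad))
        where
        isBad : badAt y u v ≡ true
        isBad rewrite mv | eq = dec-true (3 * toℕ (y v) ≟ⁿ 3 * toℕ (y v)) refl

-- Neighbour sums split by side, and reflected shifts.

over-∧ : ∀ {n} (P Q : Fin n → Bool) f → over (λ w → P w ∧ Q w) f ≡ over P (λ w → if Q w then f w else 0)
over-∧ P Q f = sum-cong pointwise
  where
  pointwise : ∀ w → (if P w ∧ Q w then f w else 0) ≡ (if P w then (if Q w then f w else 0) else 0)
  pointwise w with P w
  ... | true  = refl
  ... | false = refl

over≡0⇒ : ∀ {n} (P : Fin n → Bool) f → over P f ≡ 0 → ∀ {v} → P v ≡ true → f v ≡ 0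
over≡0⇒ P f eq Pv = n≤0⇒n≡0 (subst (_ ≤_) eq (term≤over P f Pv))

∧-elim : ∀ a b → a ∧ b ≡ true → a ≡ true × b ≡ true
∧-elim true b b≡true = refl , b≡true

same⇒≡ : ∀ a b → same a b ≡ true → a ≡ b
same⇒≡ true  true  _ = refl
same⇒≡ false false _ = refl

-- Turns a shift into ρ: the false side starts at 0 and moves up, the true side starts at 3 and
-- moves down.
reflect : Bool → ℕ → ℕ
reflect true  k = 3 ∸ k
reflect false k = k

reflect≤3 : ∀ b {k} → k ≤ 3 → reflect b k ≤ 3
reflect≤3 true  {k} _ = m∸n≤m 3 k
reflect≤3 false k≤3   = k≤3

-- The contribution of one neighbour to σ, with every negative term moved to the other side so that
-- no truncated subtraction survives the summation.
reflect-false : ∀ {a} b {k} → a ≡ false → k ≤ 3 →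
  reflect b k + ((if not (same a b) then k else 0) + 3 * 𝟙 (same a b)) ≡ (if same a b then k else 0) + 3
reflect-false true  {k} refl k≤3 = trans (cong (3 ∸ k +_) (+-identityʳ k)) (m∸n+n≡m k≤3)
reflect-false false refl _       = refl

reflect-true : ∀ {a} b {k} → a ≡ true → k ≤ 3 →
  reflect b k + (if same a b then k else 0) ≡ (if not (same a b) then k else 0) + 3 * 𝟙 (same a b)
reflect-true true  refl k≤3 = m∸n+n≡m k≤3
reflect-true false refl _   = refl

-- Sides, chosen vertices and movable vertices.

module Scheme {n} (G : Graph n) (cubic : Cubic G) where

  module AdjCut = Cut (adj G) (Graph.sym G) (irrefl G)

  abstract
    side : Fin n → Bool
    side = proj₁ AdjCut.locallyMaximalCut

    -- From within ≤ across and within + across = 3 it follows that 2 · within ≤ 3.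
    few-within : ∀ u → AdjCut.within side u ≤ 1
    few-within u = half (proj₂ AdjCut.locallyMaximalCut u) (trans (AdjCut.within+across side u) (cubic u))
      where
      half : ∀ {a b} → a ≤ b → a + b ≡ 3 → a ≤ 1
      half {a} a≤b eq = s≤s⁻¹ (*-cancelˡ-< 2 a 2 (s≤s (subst (2 * a ≤_) eq
        (+-monoʳ-≤ a (≤-trans (≤-reflexive (+-identityʳ a)) a≤b)))))

  -- The monochromatic edges and the cut edges.
  S O : Fin n → Fin n → Bool
  S u w = adj G u w ∧ same (side u) (side w)
  O u w = adj G u w ∧ not (same (side u) (side w))

  S-atMostOne : ∀ u → over (S u) (const 1) ≤ 1
  S-atMostOne u = subst (_≤ 1) (≡-sym (over-∧ (adj G u) (λ w → same (side u) (side w)) (const 1))) (few-within u)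

  symmetric : ∀ (f : Bool → Bool) a b → adj G a b ∧ f (same (side a) (side b)) ≡ adj G b a ∧ f (same (side b) (side a))
  symmetric f a b = cong₂ (λ e s → e ∧ f s) (Graph.sym G a b) (same-sym (side a) (side b))

  S-O-disjoint : ∀ {a b} → S a b ≡ true → O a b ≡ false
  S-O-disjoint {a} {b} Sab with ∧-elim (adj G a b) _ Sab
  ... | ab , s = cong₂ (λ e t → e ∧ not t) ab s

  module Sel = Selection S O (symmetric (λ b → b)) (λ a → cong (_∧ same (side a) (side a)) (irrefl G a))
                 (symmetric not) (λ a → cong (_∧ not (same (side a) (side a))) (irrefl G a)) S-O-disjoint S-atMostOne
  open Sel using (Transversal; load)
  open Transversal

  abstract
    chosen : Fin n → Bool
    chosen = proj₁ Sel.balancedTransversal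

    transversal : Transversal chosen
    transversal = proj₁ (proj₂ Sel.balancedTransversal)

    balanced : ∀ {u w} → S u w ≡ true → chosen u ≡ true → load chosen u ≤ load chosen w
    balanced = proj₂ (proj₂ Sel.balancedTransversal)

  obstacles : Fin n → ℕ
  obstacles w = over (adj G w) (λ v → 𝟙 (same (side w) (side v) ∨ chosen v))

  -- Without obstacles, all neighbours are unshifted vertices of the false side, with ρ = 0; then σ
  -- depends on the vertex's own shift alone.
  movable : Fin n → Bool
  movable w = side w ∧ (obstacles w ≡ᵇ 0)

  module _ {v} (mv : movable v ≡ true) where

    movable⇒side : side v ≡ true
    movable⇒side = proj₁ (∧-elim (side v) _ mv)

    private
      clear : ∀ {u} → adj G v u ≡ true → same (side v) (side u) ∨ chosen u ≡ false
      clear {u} vu = 𝟙≡0 _ (over≡0⇒ (adj G v) (λ u → 𝟙 (same (side v) (side u) ∨ chosen u)) (≡ᵇ⇒≡ _ _ (subst T (≡-sym (proj₂ (∧-elim (side v) _ mv))) _)) vu)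
        where
        𝟙≡0 : ∀ b → 𝟙 b ≡ 0 → b ≡ false
        𝟙≡0 false _ = refl

    movable⇒¬S : ∀ {u} → S v u ≢ true
    movable⇒¬S {u} Svu with ∧-elim (adj G v u) _ Svu
    ... | vu , s with trans (≡-sym (cong (_∨ _) s)) (clear vu)
    ...   | ()

    movable⇒¬chosen-neighbour : ∀ {u} → adj G v u ≡ true → chosen u ≡ false
    movable⇒¬chosen-neighbour {u} vu with same (side v) (side u) | clear vu
    ... | false | eq = eq

    movable⇒¬chosen : chosen v ≡ false
    movable⇒¬chosen with chosen v in eq
    ... | false = refl
    ... | true  = contradiction (proj₂ (onlyMated transversal eq)) movable⇒¬S

  push : Bool → Fin 4
  push b = if b then 1F else 0F

  -- A neighbour on u's own side is shifted by 1 (u being unshifted) in the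
  -- direction opposite to those across, off by 3 from their start: 3 − 1 = 2.
  fixed : Fin n → Fin n → Fin 4
  fixed u w = if same (side u) (side w) then 2F else push (chosen w)

  module MF = MeanFree G cubic movable fixed

  abstract
    free : Fin n → Fin 4
    free = proj₁ MF.meanFree

    free-meanFree : ∀ {u v} → adj G u v ≡ true → movable v ≡ true → MF.total free u ≢ 3 * toℕ (free v)
    free-meanFree = proj₂ MF.meanFree

  shift : Fin n → ℕ
  shift w = toℕ (if movable w then free w else push (chosen w))

  shift≤3 : ∀ w → shift w ≤ 3
  shift≤3 w = toℕ≤pred[n] (if movable w then free w else push (chosen w))

  toℕ-push : ∀ b → toℕ (push b) ≡ 𝟙 b
  toℕ-push true  = refl
  toℕ-push false = refl

  shift-movable : ∀ {w} → movable w ≡ true → shift w ≡ toℕ (free w)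
  shift-movable mw rewrite mw = refl

  shift-fixed : ∀ {w} → movable w ≡ false → shift w ≡ 𝟙 (chosen w)
  shift-fixed {w} mw rewrite mw = toℕ-push (chosen w)

  chosen⇒fixed : ∀ {w} → chosen w ≡ true → movable w ≡ false
  chosen⇒fixed {w} pw with movable w in mw
  ... | false = refl
  ... | true  = trans (≡-sym pw) (movable⇒¬chosen mw)

  S⇒fixed : ∀ {u w} → S u w ≡ true → movable u ≡ false
  S⇒fixed {u} Suw with movable u in mu
  ... | false = refl
  ... | true  = contradiction Suw (movable⇒¬S mu)

  chosen≤shift : ∀ w → 𝟙 (chosen w) ≤ shift w
  chosen≤shift w = cases (chosen w) refl
    where
    cases : ∀ b → chosen w ≡ b → 𝟙 b ≤ shift w
    cases false _  = z≤n
    cases true  pw = ≤-reflexive (≡-sym (trans (shift-fixed (chosen⇒fixed pw)) (cong 𝟙 pw)))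

  -- The scheme and its values of σ.

  ρ : Fin n → ℕ
  ρ w = reflect (side w) (shift w)

  ρ≤3 : ∀ w → ρ w ≤ 3
  ρ≤3 w = reflect≤3 (side w) (shift≤3 w)

  mates pushAcross pushWithin pushes : Fin n → ℕ
  mates u      = over (S u) (const 1)
  pushAcross u = over (O u) shift
  pushWithin u = over (S u) shift
  pushes u     = over (adj G u) ρ

  sigma≡ : ∀ u → sigma G ρ u ≡ (1 + ρ u) * 3 + pushes u
  sigma≡ u = cong (λ d → (1 + ρ u) * d + pushes u) (cubic u)

  over-S : ∀ u f → over (S u) f ≡ over (adj G u) (λ w → if same (side u) (side w) then f w else 0)
  over-S u = over-∧ (adj G u) (λ w → same (side u) (side w))

  over-O : ∀ u f → over (O u) f ≡ over (adj G u) (λ w → if not (same (side u) (side w)) then f w else 0)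
  over-O u = over-∧ (adj G u) (λ w → not (same (side u) (side w)))

  pushes-false : ∀ u → side u ≡ false → pushes u + (pushAcross u + 3 * mates u) ≡ pushWithin u + 9
  pushes-false u cu = begin
    pushes u + (pushAcross u + 3 * mates u)
      ≡⟨ cong₂ (λ k l → pushes u + (k + l)) (over-O u shift) (trans (cong (3 *_) (over-S u (const 1))) (≡-sym (over-* (adj G u) 3 _))) ⟩
    pushes u + (over (adj G u) across + over (adj G u) threes)
      ≡⟨ cong (pushes u +_) (over-+ (adj G u) across threes) ⟨
    pushes u + over (adj G u) (λ w → across w + threes w)
      ≡⟨ over-+ (adj G u) ρ _ ⟨
    over (adj G u) (λ w → ρ w + (across w + threes w))
      ≡⟨ over-cong (adj G u) (λ w _ → reflect-false (side w) cu (shift≤3 w)) ⟩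
    over (adj G u) (λ w → within w + 3 * 1)
      ≡⟨ over-+ (adj G u) within (const (3 * 1)) ⟩
    over (adj G u) within + over (adj G u) (const (3 * 1))
      ≡⟨ cong₂ _+_ (≡-sym (over-S u shift)) (trans (over-* (adj G u) 3 (const 1)) (cong (3 *_) (cubic u))) ⟩
    pushWithin u + 9 ∎
    where
    open ≡-Reasoning
    across within threes : Fin n → ℕ
    across w = if not (same (side u) (side w)) then shift w else 0
    within w = if same (side u) (side w) then shift w else 0
    threes w = 3 * 𝟙 (same (side u) (side w))

  pushes-true : ∀ u → side u ≡ true → pushes u + pushWithin u ≡ pushAcross u + 3 * mates u
  pushes-true u cu = begin
    pushes u + pushWithin u
      ≡⟨ cong (pushes u +_) (over-S u shift) ⟩
    pushes u + over (adj G u) within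
      ≡⟨ over-+ (adj G u) ρ within ⟨
    over (adj G u) (λ w → ρ w + within w)
      ≡⟨ over-cong (adj G u) (λ w _ → reflect-true (side w) cu (shift≤3 w)) ⟩
    over (adj G u) (λ w → across w + threes w)
      ≡⟨ over-+ (adj G u) across threes ⟩
    over (adj G u) across + over (adj G u) threes
      ≡⟨ cong₂ _+_ (over-O u shift) (trans (cong (3 *_) (over-S u (const 1))) (≡-sym (over-* (adj G u) 3 _))) ⟨
    pushAcross u + 3 * mates u ∎
    where
    open ≡-Reasoning
    across within threes : Fin n → ℕ
    across w = if not (same (side u) (side w)) then shift w else 0
    within w = if same (side u) (side w) then shift w else 0
    threes w = 3 * 𝟙 (same (side u) (side w))

  mate-shift : ∀ {u w} → S u w ≡ true → shift w ≡ 𝟙 (not (chosen u))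
  mate-shift {u} {w} Suw = trans (shift-fixed (S⇒fixed (trans (symmetric (λ b → b) w u) Suw)))
                                 (cong 𝟙 (exactlyOne transversal Suw))

  chosen⇒mates : ∀ {u} → chosen u ≡ true → mates u ≡ 1
  chosen⇒mates {u} pu = ≤-antisym (S-atMostOne u) (term≤over (S u) (const 1) (proj₂ (onlyMated transversal pu)))

  chosen⇒within : ∀ {u} → chosen u ≡ true → pushWithin u ≡ 0
  chosen⇒within {u} pu = over-zero (S u) λ w Suw → trans (mate-shift Suw) (cong (𝟙 ∘ not) pu)

  unchosen⇒within : ∀ {u} → chosen u ≡ false → pushWithin u ≡ mates u
  unchosen⇒within {u} pu = over-cong (S u) λ w Suw → trans (mate-shift Suw) (cong (𝟙 ∘ not) pu)

  -- The distance d of σ from 12 at vertices that are not movable. A mate accounts for 3. At a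
  -- chosen vertex its own shift cancels this; at an unchosen one the mate's shift takes back only
  -- 1, leaving 2.
  defect : Fin n → ℕ
  defect u = if chosen u then pushAcross u else pushAcross u + 2 * mates u

  across≤defect : ∀ u → pushAcross u ≤ defect u
  across≤defect u with chosen u
  ... | true  = ≤-refl
  ... | false = m≤m+n _ _

  side-false⇒fixed : ∀ {u} → side u ≡ false → movable u ≡ false
  side-false⇒fixed {u} cu = cong (_∧ (obstacles u ≡ᵇ 0)) cu

  sigma-false : ∀ u → side u ≡ false → sigma G ρ u + defect u ≡ 12
  sigma-false u cu = trans (cong (_+ defect u) (trans (sigma≡ u) (cong (λ r → (1 + r) * 3 + pushes u) ρu))) main
    where
    open ≡-Reasoning
    ρu : ρ u ≡ 𝟙 (chosen u)
    ρu = trans (cong (λ b → reflect b (shift u)) cu) (shift-fixed (side-false⇒fixed cu))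
    main : (1 + 𝟙 (chosen u)) * 3 + pushes u + defect u ≡ 12
    main with chosen u in pu
    -- The added 3 is `3 * mates u`, which completes the left side of `pushes-false`.
    ... | true  = +-cancelʳ-≡ 3 _ _ (begin
      6 + pushes u + pushAcross u + 3                ≡⟨ regroup (pushes u) (pushAcross u) ⟩
      6 + (pushes u + (pushAcross u + 3 * 1))        ≡⟨ cong (λ k → 6 + (pushes u + (pushAcross u + 3 * k))) (chosen⇒mates pu) ⟨
      6 + (pushes u + (pushAcross u + 3 * mates u))  ≡⟨ cong (6 +_) (pushes-false u cu) ⟩
      6 + (pushWithin u + 9)                         ≡⟨ cong (λ k → 6 + (k + 9)) (chosen⇒within pu) ⟩
      15                                             ∎)
      where
      regroup : ∀ a b → 6 + a + b + 3 ≡ 6 + (a + (b + 3 * 1))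
      regroup = solve-∀
    ... | false = +-cancelʳ-≡ (mates u) _ _ (begin
      3 + pushes u + (pushAcross u + 2 * mates u) + mates u  ≡⟨ regroup (pushes u) (pushAcross u) (mates u) ⟩
      3 + (pushes u + (pushAcross u + 3 * mates u))          ≡⟨ cong (3 +_) (pushes-false u cu) ⟩
      3 + (pushWithin u + 9)                                 ≡⟨ cong (λ k → 3 + (k + 9)) (unchosen⇒within pu) ⟩
      3 + (mates u + 9)                                      ≡⟨ cong (3 +_) (+-comm (mates u) 9) ⟩
      12 + mates u                                           ∎)
      where
      regroup : ∀ a b c → 3 + a + (b + 2 * c) + c ≡ 3 + (a + (b + 3 * c))
      regroup = solve-∀

  sigma-true : ∀ v → side v ≡ true → movable v ≡ false → sigma G ρ v ≡ 12 + defect v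
  sigma-true v cv mv = trans (trans (sigma≡ v) (cong (λ r → (1 + r) * 3 + pushes v) ρv)) main
    where
    open ≡-Reasoning
    ρv : ρ v ≡ 3 ∸ 𝟙 (chosen v)
    ρv = trans (cong (λ b → reflect b (shift v)) cv) (cong (3 ∸_) (shift-fixed mv))
    main : (1 + (3 ∸ 𝟙 (chosen v))) * 3 + pushes v ≡ 12 + defect v
    main with chosen v in pv
    ... | true  = begin
      9 + pushes v                          ≡⟨ cong (9 +_) (+-identityʳ (pushes v)) ⟨
      9 + (pushes v + 0)                    ≡⟨ cong (λ k → 9 + (pushes v + k)) (chosen⇒within pv) ⟨
      9 + (pushes v + pushWithin v)         ≡⟨ cong (9 +_) (pushes-true v cv) ⟩
      9 + (pushAcross v + 3 * mates v)      ≡⟨ cong (λ k → 9 + (pushAcross v + 3 * k)) (chosen⇒mates pv) ⟩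
      9 + (pushAcross v + 3)                ≡⟨ cong (9 +_) (+-comm (pushAcross v) 3) ⟩
      12 + pushAcross v                     ∎
    ... | false = cong (12 +_) (+-cancelʳ-≡ (mates v) _ _ (begin
      pushes v + mates v                       ≡⟨ cong (pushes v +_) (unchosen⇒within pv) ⟨
      pushes v + pushWithin v                  ≡⟨ pushes-true v cv ⟩
      pushAcross v + 3 * mates v               ≡⟨ regroup (pushAcross v) (mates v) ⟩
      pushAcross v + 2 * mates v + mates v     ∎))
      where
      regroup : ∀ b c → b + 3 * c ≡ b + 2 * c + c
      regroup = solve-∀

  -- All neighbours have ρ = 0, so σ is just three times 1 + ρ.
  sigma-movable : ∀ v → movable v ≡ true → sigma G ρ v + 3 * shift v ≡ 12
  sigma-movable v mv = begin
    sigma G ρ v + 3 * shift v                      ≡⟨ cong (_+ 3 * shift v) (sigma≡ v) ⟩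
    (1 + ρ v) * 3 + pushes v + 3 * shift v         ≡⟨ cong₂ (λ r k → (1 + r) * 3 + k + 3 * shift v) ρv no-pushes ⟩
    (1 + (3 ∸ shift v)) * 3 + 0 + 3 * shift v      ≡⟨ regroup (3 ∸ shift v) (shift v) ⟩
    3 + 3 * (3 ∸ shift v + shift v)                ≡⟨ cong (λ k → 3 + 3 * k) (m∸n+n≡m (shift≤3 v)) ⟩
    12                                             ∎
    where
    open ≡-Reasoning
    ρv : ρ v ≡ 3 ∸ shift v
    ρv = cong (λ b → reflect b (shift v)) (movable⇒side mv)
    regroup : ∀ a b → (1 + a) * 3 + 0 + 3 * b ≡ 3 + 3 * (a + b)
    regroup = solve-∀
    no-pushes : pushes v ≡ 0
    no-pushes = over-zero (adj G v) λ w vw → silent w vw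
      where
      silent : ∀ w → adj G v w ≡ true → ρ w ≡ 0
      silent w vw = trans (cong (λ b → reflect b (shift w)) cw)
        (trans (shift-fixed (side-false⇒fixed cw)) (cong 𝟙 (movable⇒¬chosen-neighbour mv vw)))
        where
        cases : ∀ b → side w ≡ b → b ≡ false
        cases false _  = refl
        cases true  cw = contradiction (cong₂ _∧_ vw (cong₂ same (movable⇒side mv) cw)) (movable⇒¬S mv)
        cw : side w ≡ false
        cw = cases (side w) refl

  -- The weight 2 that `fixed` gives to a mate makes the total around an unchosen vertex of the
  -- false side equal to its defect.
  total≡ : ∀ u → side u ≡ false → MF.total free u ≡ pushAcross u + 2 * mates u
  total≡ u cu = begin
    MF.total free u
      ≡⟨ over-cong (adj G u) (λ w _ → pointwise w) ⟩
    over (adj G u) (λ w → across w + twos w)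
      ≡⟨ over-+ (adj G u) across twos ⟩
    over (adj G u) across + over (adj G u) twos
      ≡⟨ cong₂ _+_ (over-O u shift) (trans (cong (2 *_) (over-S u (const 1))) (≡-sym (over-* (adj G u) 2 _))) ⟨
    pushAcross u + 2 * mates u ∎
    where
    open ≡-Reasoning
    across twos : Fin n → ℕ
    across w = if not (same (side u) (side w)) then shift w else 0
    twos w = 2 * 𝟙 (same (side u) (side w))
    split : ∀ m b {x z} → (b ≡ true → m ≡ false) → toℕ (if m then x else (if b then 2F else z)) ≡
            (if not b then toℕ (if m then x else z) else 0) + 2 * 𝟙 b
    split false false _ = ≡-sym (+-identityʳ _)
    split true  false _ = ≡-sym (+-identityʳ _)
    split false true  _ = refl
    split true  true  e = contradiction (e refl) λ ()
    pointwise : ∀ w → toℕ (MF.value free u w) ≡ across w + twos w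
    pointwise w = split (movable w) (same (side u) (side w))
      (λ s → side-false⇒fixed (trans (≡-sym (same⇒≡ (side u) (side w) s)) cu))

  load≤across : ∀ u → load chosen u ≤ pushAcross u
  load≤across u = over-mono (O u) λ w _ → chosen≤shift w

  -- A chosen vertex is an obstacle to its neighbours, so none of them is movable and the free
  -- shifts do not enter its defect.
  across-chosen : ∀ {u} → chosen u ≡ true → pushAcross u ≡ load chosen u
  across-chosen {u} pu = over-cong (O u) λ w Ouw → shift-fixed (neighbour-fixed w (proj₁ (∧-elim (adj G u w) _ Ouw)))
    where
    neighbour-fixed : ∀ w → adj G u w ≡ true → movable w ≡ false
    neighbour-fixed w uw with movable w in mw
    ... | false = refl
    ... | true  = trans (≡-sym pu) (movable⇒¬chosen-neighbour mw (trans (Graph.sym G w u) uw))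

  -- Absence of conflicts.

  -- Balance gives load `u` ≤ load `w`, and the unchosen end `w` has an additional 2 from its mate.
  defect-mates : ∀ {u w} → S u w ≡ true → chosen u ≡ true → defect u < defect w
  defect-mates {u} {w} Suw pu = begin-strict
    defect u                        ≡⟨ cong (λ b → if b then pushAcross u else pushAcross u + 2 * mates u) pu ⟩
    pushAcross u                    ≡⟨ across-chosen pu ⟩
    load chosen u                   ≤⟨ balanced Suw pu ⟩
    load chosen w                   ≤⟨ load≤across w ⟩
    pushAcross w                    <⟨ m<m+n (pushAcross w) (*-mono-≤ {1} {2} (s≤s z≤n) (term≤over (S w) (const 1) (trans (symmetric (λ b → b) w u) Suw))) ⟩
    pushAcross w + 2 * mates w      ≡⟨ cong (λ b → if b then pushAcross w else pushAcross w + 2 * mates w) (trans (exactlyOne transversal Suw) (cong not pu)) ⟨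
    defect w                        ∎
    where open ≤-Reasoning

  sigma≢-within : ∀ {u w} → S u w ≡ true → chosen u ≡ true → sigma G ρ u ≢ sigma G ρ w
  sigma≢-within {u} {w} Suw pu eq = <⇒≢ (defect-mates Suw pu) (defect≡ (side u) refl)
    where
    side≡ = same⇒≡ (side u) (side w) (proj₂ (∧-elim (adj G u w) _ Suw))
    Swu = trans (symmetric (λ b → b) w u) Suw
    defect≡ : ∀ b → side u ≡ b → defect u ≡ defect w
    defect≡ false cu = +-cancelˡ-≡ (sigma G ρ u) _ _ (trans (sigma-false u cu)
      (trans (≡-sym (sigma-false w (trans (≡-sym side≡) cu))) (cong (_+ defect w) (≡-sym eq))))
    defect≡ true cu = +-cancelˡ-≡ 12 _ _ (trans (≡-sym (sigma-true u cu (S⇒fixed Suw)))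
      (trans eq (sigma-true w (trans (≡-sym side≡) cu) (S⇒fixed Swu))))

  -- If `v` is chosen, its shift counts in the defect of `u`. Otherwise `v` has an obstacle, and
  -- either a mate or a chosen neighbour across the cut makes its own defect positive.
  defect-positive : ∀ {u v} → adj G u v ≡ true → side u ≡ false → side v ≡ true → movable v ≡ false →
                    0 < defect u + defect v
  defect-positive {u} {v} uv cu cv mv with chosen v in pv
  ... | true  = ≤-trans (≤-trans (≤-trans (subst (_≤ shift v) (cong 𝟙 pv) (chosen≤shift v))
                  (term≤over (O u) shift Ouv)) (across≤defect u)) (m≤m+n _ _)
    where
    Ouv : O u v ≡ true
    Ouv = cong₂ _∧_ uv (cong₂ (λ a b → not (same a b)) cu cv)
  ... | false = ≤-trans (≤-trans obstructed (≤-trans obstacles≤ (+-monoʳ-≤ (pushAcross v) (m≤m+n (mates v) _)))) (m≤n+m _ (defect u))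
    where
    positive : ∀ k → (k ≡ᵇ 0) ≡ false → 1 ≤ k
    positive (suc k) _ = s≤s z≤n
    obstructed : 1 ≤ obstacles v
    obstructed = positive (obstacles v) (trans (≡-sym (cong (_∧ (obstacles v ≡ᵇ 0)) cv)) mv)
    obstacles≤ : obstacles v ≤ pushAcross v + mates v
    obstacles≤ = subst (obstacles v ≤_)
      (trans (over-+ (adj G v) _ _) (cong₂ _+_ (≡-sym (over-O v shift)) (≡-sym (over-S v (const 1)))))
      (over-mono (adj G v) λ w _ → pointwise w (same (side v) (side w)))
      where
      pointwise : ∀ w b → 𝟙 (b ∨ chosen w) ≤ (if not b then shift w else 0) + (if b then 1 else 0)
      pointwise w true  = s≤s z≤n
      pointwise w false = ≤-trans (chosen≤shift w) (m≤m+n _ _)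

  -- If `v` is not movable, equality of 12 - d and 12 + d′ would force both defects to vanish. If it
  -- is movable, `u` is unchosen, and equality would make the shift of `v` the mean around `u`.
  sigma≢-across : ∀ {u v} → adj G u v ≡ true → side u ≡ false → side v ≡ true → sigma G ρ u ≢ sigma G ρ v
  sigma≢-across {u} {v} uv cu cv eq = cases (movable v) refl
    where
    open ≡-Reasoning
    regroup : ∀ a b → 12 + (a + b) ≡ 12 + b + a
    regroup = solve-∀
    cases : ∀ b → movable v ≡ b → ⊥
    cases false mv = <⇒≢ (defect-positive uv cu cv mv) (≡-sym (+-cancelˡ-≡ 12 _ 0 (begin
      12 + (defect u + defect v)     ≡⟨ regroup (defect u) (defect v) ⟩
      12 + defect v + defect u       ≡⟨ cong (_+ defect u) (sigma-true v cv mv) ⟨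
      sigma G ρ v + defect u         ≡⟨ cong (_+ defect u) eq ⟨
      sigma G ρ u + defect u         ≡⟨ sigma-false u cu ⟩
      12                             ∎)))
    cases true mv = free-meanFree uv mv (trans (+-cancelˡ-≡ (sigma G ρ u) _ _ (begin
      sigma G ρ u + MF.total free u                ≡⟨ cong (sigma G ρ u +_) (total≡ u cu) ⟩
      sigma G ρ u + (pushAcross u + 2 * mates u)   ≡⟨ cong (sigma G ρ u +_) unchosen ⟨
      sigma G ρ u + defect u                       ≡⟨ sigma-false u cu ⟩
      12                                           ≡⟨ sigma-movable v mv ⟨
      sigma G ρ v + 3 * shift v                    ≡⟨ cong (_+ 3 * shift v) eq ⟨
      sigma G ρ u + 3 * shift v                    ∎)) (cong (3 *_) (shift-movable mv)))
      where
      unchosen : defect u ≡ pushAcross u + 2 * mates u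
      unchosen = cong (λ b → if b then pushAcross u else pushAcross u + 2 * mates u)
                   (movable⇒¬chosen-neighbour mv (trans (Graph.sym G v u) uv))

  proper : ProperPushingScheme G ρ
  proper u v uv with same (side u) (side v) in eq
  ... | false = across (side u) (side v) refl refl eq
    where
    across : ∀ a b → side u ≡ a → side v ≡ b → same a b ≡ false → sigma G ρ u ≢ sigma G ρ v
    across false true cu cv _ = sigma≢-across uv cu cv
    across true false cu cv _ = sigma≢-across (trans (Graph.sym G v u) uv) cv cu ∘ ≡-sym
  ... | true  = within (chosen u) refl
    where
    Suv : S u v ≡ true
    Suv = cong₂ _∧_ uv eq
    within : ∀ b → chosen u ≡ b → sigma G ρ u ≢ sigma G ρ v
    within true  pu = sigma≢-within Suv pu
    -- Exactly one end of a monochromatic edge is chosen, so here it is `v`.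
    within false pu = sigma≢-within (trans (symmetric (λ b → b) v u) Suv)
                        (trans (exactlyOne transversal Suv) (cong not pu)) ∘ ≡-sym

theorem1 : ∀ {n} (G : Graph n) → Cubic G →
    Σ (Fin n → ℕ) (λ ρ → ((u : Fin n) → ρ u ≤ 3) × ProperPushingScheme G ρ)
theorem1 G cubic = ρ , ρ≤3 , proper
  where open Scheme G cubic
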